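{- The cactus group $J_n$ has trivial center whenever $n>2$, and the pure cactus group $PJ_n$ has trivial center whenever $n>3$.
   Context: For $n \ge 2$, the cactus group $J_n$ is the group with generators $s_{p,q}$ for $1 \le p < q \le n$ and relations: (j1) $s_{p,q}^2 = 1$; (j2) $s_{p,q}s_{m,r} = s_{m,r}s_{p,q}$ whenever $[p,q]\cap[m,r]=\emptyset$; (j3) $s_{p,q}s_{m,r} = s_{p+q-r,\,p+q-m}\,s_{p,q}$ whenever $[m,r]\subset[p,q]$. There is a homomorphism $s\colon J_n\to S_n$ sending $s_{p,q}$ to the permutation of $\{1,\dots,n\}$ that reverses the order of $p,p+1,\dots,q$ and fixes all other elements. The pure cactus group $PJ_n$ is the kernel of $s$. -}

module Defs where

open import Data.Nat using (ℕ; _+_; _∸_; _≤_; _<_; _≤ᵇ_)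
open import Data.Bool using (if_then_else_; _∧_)
open import Data.List using (List; []; _∷_; _++_)
open import Data.Sum using (_⊎_)
open import Data.Product using (_×_)
open import Relation.Binary.PropositionalEquality using (_≡_)

record Gen (n : ℕ) : Set where
  constructor gen
  field
    p   : ℕ
    q   : ℕ
    1≤p : 1 ≤ p
    p<q : p < q
    q≤n : q ≤ n

open Gen public

-- Words in the generators.  Since every generator is an involution (j1),
-- the group J_n is the quotient of the free monoid on the generators by
-- the congruence generated by (j1)-(j3); multiplication is concatenation,
-- the identity is [] and the inverse of a word is its reverse.
Word : ℕ → Set
Word n = List (Gen n)

data Rel {n : ℕ} : Word n → Word n → Set where
  j1 : (g : Gen n) → Rel (g ∷ g ∷ []) []
  j2 : (g h : Gen n) → (q g < p h ⊎ q h < p g) →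
       Rel (g ∷ h ∷ []) (h ∷ g ∷ [])
  -- (j3) s_{p,q} s_{m,r} = s_{p+q-r, p+q-m} s_{p,q} when [m,r] ⊆ [p,q];
  -- h' is the generator s_{p+q-r, p+q-m}, specified by its endpoints.
  j3 : (g h h' : Gen n) → p g ≤ p h → q h ≤ q g →
       p h' + q h ≡ p g + q g → q h' + p h ≡ p g + q g →
       Rel (g ∷ h ∷ []) (h' ∷ g ∷ [])

infix 4 _≈_
data _≈_ {n : ℕ} : Word n → Word n → Set where
  ≈-refl  : {w : Word n} → w ≈ w
  ≈-sym   : {w v : Word n} → w ≈ v → v ≈ w
  ≈-trans : {u v w : Word n} → u ≈ v → v ≈ w → u ≈ w
  ≈-rel   : (u v : Word n) {l r : Word n} → Rel l r →
            (u ++ l ++ v) ≈ (u ++ r ++ v)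

-- The permutation of {1,…,n} (extended by the identity to ℕ) reversing p..q.
rev : {n : ℕ} → Gen n → ℕ → ℕ
rev g i = if (p g ≤ᵇ i) ∧ (i ≤ᵇ q g) then (p g + q g) ∸ i else i

-- The homomorphism s : J_n → S_n on words, as a function on points.
act : {n : ℕ} → Word n → ℕ → ℕ
act []      i = i
act (g ∷ w) i = rev g (act w i)

Pure : (n : ℕ) → Word n → Set
Pure n w = (i : ℕ) → 1 ≤ i → i ≤ n → act w i ≡ i

{-# OPTIONS --safe #-}

-- J_n maps to the semidirect product of S_n with the right-angled Coxeter group on the
-- subsets of {1,…,n}, where two subsets commute when they are nested or disjoint; s_{p,q}
-- goes to the letter [p,q] times the reversal.  Every commutation in the image lifts to a
-- relation (j2) or (j3), so reduced words, length ℓ and left descents make sense in J_n,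
-- and two left descents of one element never cross (overlap without being nested).
--
-- Let w be reduced with first letter a, and let g cross a.  If v satisfies
-- ℓ(v w) = ℓ(v) + ℓ(w) and g is a descent of v w, then v w ≠ w v, because a would be a
-- descent of w v while g is one of v w.  In J_n take v = g.  In PJ_n take
-- v = (g a)ᵐ (a g′)ᵐ with a second letter g′ crossing a; such a g′ exists once n > 3.
-- Hence a central w can only begin with the letter [1,n], which forces w = s_{1,n};
-- that element is neither central in J_n nor pure.
module Submission where

open import Defs
open import Algebra.Properties.CommutativeSemigroup using (interchange)
open import Data.Bool using (Bool; true; false; T)
open import Data.Bool.Properties using () renaming (_≟_ to _≟ᵇ_)
open import Data.Fin using (Fin; toℕ; fromℕ<)
open import Data.Fin.Properties using (toℕ<n; toℕ-fromℕ<; toℕ-injective; all?; pigeonhole)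
open import Data.List using (List; []; _∷_; _++_; map; length; foldr)
open import Data.List.Properties using (map-id; map-∘; map-cong; ++-assoc; foldr-++; length-map; length-++)
open import Data.Nat
open import Data.Nat.Divisibility using (divides; ∣-trans; m∣m*n; m≤n⇒m!∣n!)
open import Data.Nat.Properties
open import Data.Product using (_×_; _,_; ∃; ∃₂; proj₁; proj₂)
open import Data.Sum using (_⊎_; inj₁; inj₂; [_,_]′)
open import Data.Vec using (Vec; lookup; tabulate)
open import Data.Vec.Properties using (≡-dec; lookup∘tabulate; tabulate∘lookup; tabulate-cong)
open import Function using (_∘_)
open import Relation.Nullary using (¬_; Dec; yes; no; does; contradiction)
open import Relation.Nullary.Decidable using (map′; _×-dec_; _⊎-dec_; _→-dec_; dec-true; dec-false)
open import Relation.Binary.Definitions using (DecidableEquality)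
open import Relation.Binary.PropositionalEquality

-- Right-angled Coxeter groups

module TraceWords {X : Set} (_≟_ : DecidableEquality X)
  (Com : X → X → Set) (com? : ∀ a b → Dec (Com a b))
  (com-refl : ∀ a → Com a a) (com-sym : ∀ {a b} → Com a b → Com b a) where

  infix 4 _~_
  data _~_ : List X → List X → Set where
    ~-refl  : ∀ {w} → w ~ w
    ~-trans : ∀ {u v w} → u ~ v → v ~ w → u ~ w
    ~-prep  : ∀ a {v w} → v ~ w → a ∷ v ~ a ∷ w
    ~-swap  : ∀ {a b} w → Com a b → a ∷ b ∷ w ~ b ∷ a ∷ w

  ~-sym : ∀ {v w} → v ~ w → w ~ v
  ~-sym ~-refl        = ~-refl
  ~-sym (~-trans p q) = ~-trans (~-sym q) (~-sym p)
  ~-sym (~-prep a p)  = ~-prep a (~-sym p)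
  ~-sym (~-swap w c)  = ~-swap w (com-sym c)

  ~-reflexive : ∀ {v w} → v ≡ w → v ~ w
  ~-reflexive refl = ~-refl

  ~-length : ∀ {v w} → v ~ w → length v ≡ length w
  ~-length ~-refl        = refl
  ~-length (~-trans p q) = trans (~-length p) (~-length q)
  ~-length (~-prep a p)  = cong suc (~-length p)
  ~-length (~-swap w c)  = refl

  -- One occurrence of `a`, preceded only by letters commuting with `a`, is removed. As `Com` is
  -- reflexive, it need not be the first occurrence.
  data Del (a : X) : List X → List X → Set where
    here  : ∀ {w} → Del a (a ∷ w) w
    there : ∀ {b w u} → Com a b → Del a w u → Del a (b ∷ w) (b ∷ u)

  Descent : X → List X → Set
  Descent a w = ∃ (Del a w)

  descent? : ∀ a w → Dec (Descent a w)
  descent? a [] = no λ ()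
  descent? a (b ∷ w) with a ≟ b
  ... | yes refl = yes (w , here)
  ... | no a≢b with com? a b
  ...   | no ¬c = no λ { (_ , here) → a≢b refl ; (_ , there c _) → ¬c c }
  ...   | yes c with descent? a w
  ...     | yes (u , d) = yes (b ∷ u , there c d)
  ...     | no ¬d = no λ { (_ , here) → a≢b refl ; (_ , there _ d) → ¬d (_ , d) }

  descent-∷ : ∀ {a b w} → Descent a (b ∷ w) → a ≡ b ⊎ Com a b × Descent a w
  descent-∷ (_ , here)      = inj₁ refl
  descent-∷ (_ , there c d) = inj₂ (c , _ , d)

  del-front : ∀ {a w u} → Del a w u → w ~ a ∷ u
  del-front here        = ~-refl
  del-front (there c d) = ~-trans (~-prep _ (del-front d)) (~-swap _ (com-sym c))

  -- All letters between two removable occurrences of `a` commute with `a`, so removing either one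
  -- gives the same word up to commutations.
  del-unique : ∀ {a w u v} → Del a w u → Del a w v → u ~ v
  del-unique here        here        = ~-refl
  del-unique here        (there _ e) = del-front e
  del-unique (there _ d) here        = ~-sym (del-front d)
  del-unique (there _ d) (there _ e) = ~-prep _ (del-unique d e)

  del-~ : ∀ {a w v u} → w ~ v → Del a w u → ∃ λ u′ → Del a v u′ × u ~ u′
  del-~ ~-refl d = _ , d , ~-refl
  del-~ (~-trans p q) d with del-~ p d
  ... | _ , d₁ , r₁ with del-~ q d₁
  ...   | _ , d₂ , r₂ = _ , d₂ , ~-trans r₁ r₂
  del-~ (~-prep b p) here = _ , here , p
  del-~ (~-prep b p) (there c d) with del-~ p d
  ... | _ , d′ , r = _ , there c d′ , ~-prep b r
  del-~ (~-swap w c) here                 = _ , there c here , ~-refl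
  del-~ (~-swap w c) (there _ here)       = _ , here , ~-refl
  del-~ (~-swap w c) (there c₁ (there c₂ d)) = _ , there c₂ (there c₁ d) , ~-swap _ c

  descent-~ : ∀ {a w v} → w ~ v → Descent a w → Descent a v
  descent-~ p (_ , d) with del-~ p d
  ... | _ , d′ , _ = _ , d′

  -- The later of the two occurrences has to pass the earlier one, and `there` records that their
  -- letters commute.
  descents-commute : ∀ {a b w} → Descent a w → Descent b w → Com a b
  descents-commute (_ , here)      (_ , here)      = com-refl _
  descents-commute (_ , here)      (_ , there c _) = com-sym c
  descents-commute (_ , there c _) (_ , here)      = c
  descents-commute (_ , there _ d) (_ , there _ e) = descents-commute (_ , d) (_ , e)

  data Reduced : List X → Set where
    []  : Reduced []
    _∷_ : ∀ {a w} → ¬ Descent a w → Reduced w → Reduced (a ∷ w)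

  reduced-~ : ∀ {v w} → v ~ w → Reduced v → Reduced w
  reduced-~ ~-refl r = r
  reduced-~ (~-trans p q) r = reduced-~ q (reduced-~ p r)
  reduced-~ (~-prep a p) (¬d ∷ r) = (λ d → ¬d (descent-~ (~-sym p) d)) ∷ reduced-~ p r
  reduced-~ (~-swap w c) (¬d ∷ (¬e ∷ r)) =
    (λ { (_ , here) → ¬d (_ , here) ; (_ , there _ e) → ¬e (_ , e) })
    ∷ ((λ { (_ , d) → ¬d (_ , there c d) }) ∷ r)

  -- Left multiplication by the involution `a` in the right-angled Coxeter group, realised on
  -- reduced words.
  insert : X → List X → List X
  insert a w with descent? a w
  ... | yes (u , _) = u
  ... | no _        = a ∷ w

  insert-descent : ∀ {a w u} → Del a w u → insert a w ~ u
  insert-descent {a} {w} d with descent? a w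
  ... | yes (_ , e) = del-unique e d
  ... | no ¬d       = contradiction (_ , d) ¬d

  insert-ascent : ∀ {a w} → ¬ Descent a w → insert a w ≡ a ∷ w
  insert-ascent {a} {w} ¬d with descent? a w
  ... | yes d = contradiction d ¬d
  ... | no _  = refl

  insert-~ : ∀ a {w v} → w ~ v → insert a w ~ insert a v
  insert-~ a {w} {v} p with descent? a w
  ... | yes (_ , d) with del-~ p d
  ...   | _ , d′ , r = ~-trans r (~-sym (insert-descent d′))
  insert-~ a p | no ¬d =
    ~-trans (~-prep a p) (~-reflexive (sym (insert-ascent λ d → ¬d (descent-~ (~-sym p) d))))

  insert-reduced : ∀ a {w} → Reduced w → Reduced (insert a w)
  insert-reduced a {w} r with descent? a w
  ... | no ¬d = ¬d ∷ r
  ... | yes (_ , d) with reduced-~ (del-front d) r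
  ...   | _ ∷ r′ = r′

  -- Reducedness matters when `a` cancels: no second `a` can then reach the front, so inserting `a`
  -- again restores the letter.
  insert-involutive : ∀ a {w} → Reduced w → insert a (insert a w) ~ w
  insert-involutive a {w} r with descent? a w
  ... | no _ = insert-descent here
  ... | yes (_ , d) with reduced-~ (del-front d) r
  ...   | ¬e ∷ _ = ~-trans (~-reflexive (insert-ascent ¬e)) (~-sym (del-front d))

  private
    -- With `w` rewritten as `b ∷ u`, the letter `b` cancels on both sides and `insert a u` is left.
    -- Since `a` and `b` differ, removing `a` leaves this `b` in place.
    insert-comm-descent : ∀ {a b w u} → Com a b → a ≢ b → Del b w u →
                          insert a (insert b w) ~ insert b (insert a w)
    insert-comm-descent {a} {b} {w} {u} c a≢b d =
      ~-trans (insert-~ a (insert-descent d))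
        (~-sym (~-trans (insert-~ b (insert-~ a (del-front d))) rest))
      where
      rest : insert b (insert a (b ∷ u)) ~ insert a u
      rest with descent? a u
      ... | yes (_ , e) = ~-trans (insert-~ b (insert-descent (there c e))) (insert-descent here)
      ... | no ¬e = ~-trans
        (insert-~ b (~-reflexive (insert-ascent λ { (_ , here) → a≢b refl ; (_ , there _ e) → ¬e (_ , e) })))
        (insert-descent (there (com-sym c) here))

    insert-comm-dec : ∀ {a b} w → Com a b → a ≢ b → Dec (Descent a w) → Dec (Descent b w) →
                      insert a (insert b w) ~ insert b (insert a w)
    insert-comm-dec w c a≢b _ (yes (_ , e)) = insert-comm-descent c a≢b e
    insert-comm-dec w c a≢b (yes (_ , d)) (no _) =
      ~-sym (insert-comm-descent (com-sym c) (λ b≡a → a≢b (sym b≡a)) d)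
    insert-comm-dec {a} {b} w c a≢b (no ¬d) (no ¬e) =
      subst₂ (λ x y → insert a x ~ insert b y) (sym (insert-ascent ¬e)) (sym (insert-ascent ¬d))
        (subst₂ _~_
          (sym (insert-ascent λ { (_ , here) → a≢b refl ; (_ , there _ d) → ¬d (_ , d) }))
          (sym (insert-ascent λ { (_ , here) → a≢b refl ; (_ , there _ e) → ¬e (_ , e) }))
          (~-swap w c))

  insert-comm : ∀ {a b} w → Com a b → insert a (insert b w) ~ insert b (insert a w)
  insert-comm {a} {b} w c with a ≟ b
  ... | yes refl = ~-refl
  ... | no a≢b   = insert-comm-dec w c a≢b (descent? a w) (descent? b w)

  -- Supplies the action for the semidirect product: relabelling letters by such an involution
  -- respects commutation classes, descents, insertion and reducedness.
  module Automorphism (σ : X → X) (σ-involutive : ∀ a → σ (σ a) ≡ a)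
    (σ-com : ∀ {a b} → Com a b → Com (σ a) (σ b)) where

    map-involutive : ∀ w → map σ (map σ w) ≡ w
    map-involutive w = trans (sym (map-∘ w)) (trans (map-cong σ-involutive w) (map-id w))

    map-~ : ∀ {v w} → v ~ w → map σ v ~ map σ w
    map-~ ~-refl        = ~-refl
    map-~ (~-trans p q) = ~-trans (map-~ p) (map-~ q)
    map-~ (~-prep a p)  = ~-prep (σ a) (map-~ p)
    map-~ (~-swap w c)  = ~-swap (map σ w) (σ-com c)

    map-del : ∀ {a w u} → Del a w u → Del (σ a) (map σ w) (map σ u)
    map-del here        = here
    map-del (there c d) = there (σ-com c) (map-del d)

    descent-map : ∀ {a w} → Descent a w → Descent (σ a) (map σ w)
    descent-map (_ , d) = _ , map-del d

    descent-map⁻ : ∀ {a w} → Descent a (map σ w) → Descent (σ a) w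
    descent-map⁻ {a} {w} d = subst (Descent (σ a)) (map-involutive w) (descent-map d)

    map-insert : ∀ a w → map σ (insert a w) ~ insert (σ a) (map σ w)
    map-insert a w with descent? a w
    ... | yes (_ , d) = ~-sym (insert-descent (map-del d))
    ... | no ¬d = ~-reflexive (sym (insert-ascent
                    λ d → ¬d (subst (λ x → Descent x w) (σ-involutive a) (descent-map⁻ d))))

    reduced-map : ∀ {w} → Reduced w → Reduced (map σ w)
    reduced-map [] = []
    reduced-map {a ∷ w} (¬d ∷ r) =
      (λ d → ¬d (subst (λ x → Descent x w) (σ-involutive a) (descent-map⁻ d))) ∷ reduced-map r

-- Intervals and their reversals

module _ {n : ℕ} where

  -- Records and data rather than synonyms, so that the generators can be inferred from the types.
  infixr 4 _,_
  infix 4 _⊑_ _∥_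

  record In (g : Gen n) (i : ℕ) : Set where
    constructor _,_
    field
      lower : p g ≤ i
      upper : i ≤ q g

  record _⊑_ (h g : Gen n) : Set where
    constructor _,_
    field
      lower : p g ≤ p h
      upper : q h ≤ q g

  -- `h′` is the reflection of `h` in the centre of `g`. The sums are those of (j3) and avoid
  -- truncated subtraction.
  record Mirror (g h h′ : Gen n) : Set where
    constructor _,_
    field
      lower : p h′ + q h ≡ p g + q g
      upper : q h′ + p h ≡ p g + q g

  data _∥_ (g h : Gen n) : Set where
    before : q g < p h → g ∥ h
    after  : q h < p g → g ∥ h

  In? : ∀ g i → Dec (In g i)
  In? g i = map′ (λ { (a , b) → a , b }) (λ { (a , b) → a , b }) (p g ≤? i ×-dec i ≤? q g)

  p≤q : (g : Gen n) → p g ≤ q g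
  p≤q g = <⇒≤ (p<q g)

  Gen-≡ : {g h : Gen n} → p g ≡ p h → q g ≡ q h → g ≡ h
  Gen-≡ {gen _ _ a b c} {gen _ _ a′ b′ c′} refl refl
    rewrite ≤-irrelevant a a′ | ≤-irrelevant b b′ | ≤-irrelevant c c′ = refl

  ⊑-antisym : {g h : Gen n} → g ⊑ h → h ⊑ g → g ≡ h
  ⊑-antisym (a , b) (c , d) = Gen-≡ (≤-antisym c a) (≤-antisym b d)

  rev-in : ∀ g {i} → In g i → rev g i ≡ (p g + q g) ∸ i
  rev-in g {i} (p≤i , i≤q) with p g ≤ᵇ i | ≤⇒≤ᵇ p≤i | i ≤ᵇ q g | ≤⇒≤ᵇ i≤q
  ... | true | _ | true | _ = refl

  rev-out : ∀ g {i} → ¬ In g i → rev g i ≡ i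
  rev-out g {i} ¬in with p g ≤ᵇ i in e₁ | i ≤ᵇ q g in e₂
  ... | false | _     = refl
  ... | true  | false = refl
  ... | true  | true  = contradiction
    (≤ᵇ⇒≤ _ _ (subst T (sym e₁) _) , ≤ᵇ⇒≤ _ _ (subst T (sym e₂) _)) ¬in

  rev-sum : ∀ g {i} → In g i → rev g i + i ≡ p g + q g
  rev-sum g {i} in-g@(_ , i≤q) =
    trans (cong (_+ i) (rev-in g in-g)) (m∸n+n≡m (≤-trans i≤q (m≤n+m (q g) (p g))))

  rev-unique : ∀ g {i j} → In g i → j + i ≡ p g + q g → rev g i ≡ j
  rev-unique g {i} in-g e = +-cancelʳ-≡ i _ _ (trans (rev-sum g in-g) (sym e))

  -- From `c + d ≡ a + b` and `a + b ≤ a + d`. It turns a bound on a point or an endpoint into the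
  -- bound on its mirror image.
  sum-≤ : ∀ {a b c d} → a + b ≡ c + d → b ≤ d → c ≤ a
  sum-≤ {a} {b} {c} {d} e b≤d = +-cancelʳ-≤ d c a
    (≤-trans (≤-reflexive (sym e)) (+-monoʳ-≤ a b≤d))

  rev-In : ∀ g {i} → In g i → In g (rev g i)
  rev-In g in-g@(p≤i , i≤q) =
    sum-≤ (rev-sum g in-g) i≤q ,
    sum-≤ (trans (+-comm (q g) (p g)) (sym (rev-sum g in-g))) p≤i

  rev-involutive : ∀ g i → rev g (rev g i) ≡ i
  rev-involutive g i with In? g i
  ... | yes in-g = rev-unique g (rev-In g in-g) (trans (+-comm i _) (rev-sum g in-g))
  ... | no ¬in   = trans (cong (rev g) (rev-out g ¬in)) (rev-out g ¬in)

  ∥⇒¬In : ∀ {g h i} → g ∥ h → In h i → ¬ In g i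
  ∥⇒¬In (before q<p) (ph≤i , _) (_ , i≤qg) = <-irrefl refl (<-≤-trans q<p (≤-trans ph≤i i≤qg))
  ∥⇒¬In (after q<p) (_ , i≤qh) (pg≤i , _) = <-irrefl refl (<-≤-trans q<p (≤-trans pg≤i i≤qh))

  ∥-sym : ∀ {g h} → g ∥ h → h ∥ g
  ∥-sym (before a) = after a
  ∥-sym (after a) = before a

  ⊑-In : ∀ {g h i} → g ⊑ h → In g i → In h i
  ⊑-In (a , b) (c , d) = ≤-trans a c , ≤-trans d b

  rev-∥ : ∀ {g h i} → g ∥ h → In h i → rev g i ≡ i
  rev-∥ {g} g∥h in-h = rev-out g (∥⇒¬In g∥h in-h)

  mirror-sym : ∀ {g h h′} → Mirror g h h′ → Mirror g h′ h
  mirror-sym {g} {h} {h′} (a , b) = trans (+-comm (p h) (q h′)) b , trans (+-comm (q h) (p h′)) a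

  mirror-⊑ : ∀ {g h h′} → h ⊑ g → Mirror g h h′ → h′ ⊑ g
  mirror-⊑ {g} (a , b) (c , d) = sum-≤ c b , sum-≤ (trans (+-comm (q g) (p g)) (sym d)) a

  mirror-In : ∀ {g h h′ i} → h ⊑ g → Mirror g h h′ → In h i → In h′ (rev g i)
  mirror-In {g} h⊑g (c , d) in-h@(ph≤i , i≤qh) =
    sum-≤ (trans s (sym c)) i≤qh , sum-≤ (trans d (sym s)) ph≤i
    where s = rev-sum g (⊑-In h⊑g in-h)

  mirror : ∀ g h → h ⊑ g → ∃ (Mirror g h)
  mirror g h (a , b) = gen (P ∸ q h) (P ∸ p h)
      (≤-trans (1≤p g) (sum-≤ c b))
      (∸-monoʳ-< (p<q h) qh≤P)
      (≤-trans (sum-≤ (trans (+-comm (q g) (p g)) (sym d)) a) (q≤n g))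
    , c , d
    where
    P = p g + q g
    qh≤P : q h ≤ P
    qh≤P = ≤-trans b (m≤n+m (q g) (p g))
    c : P ∸ q h + q h ≡ P
    c = m∸n+n≡m qh≤P
    d : P ∸ p h + p h ≡ P
    d = m∸n+n≡m (≤-trans (p≤q h) qh≤P)

  rev-comm-∥ : ∀ {g h} → g ∥ h → ∀ i → rev g (rev h i) ≡ rev h (rev g i)
  rev-comm-∥ {g} {h} g∥h i with In? h i | In? g i
  ... | yes in-h | _ = trans (rev-∥ g∥h (rev-In h in-h)) (cong (rev h) (sym (rev-∥ g∥h in-h)))
  ... | no ¬h | yes in-g = trans (cong (rev g) (rev-out h ¬h)) (sym (rev-∥ (∥-sym g∥h) (rev-In g in-g)))
  ... | no ¬h | no ¬g = trans (cong (rev g) (rev-out h ¬h))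
                          (trans (rev-out g ¬g) (sym (trans (cong (rev h) (rev-out g ¬g)) (rev-out h ¬h))))

  -- On `h`, the image under `rev h′` is pinned down by its sum with the argument, so one sum has to
  -- be computed. Off `h`, the point `rev g i` misses `h′`, since mirroring back would put `i` in
  -- `h`.
  rev-mirror : ∀ {g h h′} → h ⊑ g → Mirror g h h′ → ∀ i → rev g (rev h i) ≡ rev h′ (rev g i)
  rev-mirror {g} {h} {h′} h⊑g m i with In? h i
  ... | no ¬h = trans (cong (rev g) (rev-out h ¬h)) (sym (rev-out h′ λ in-h′ → ¬h
          (subst (In h) (rev-involutive g i)
            (mirror-In (mirror-⊑ h⊑g m) (mirror-sym m) in-h′))))
  ... | yes in-h = sym (rev-unique h′ (mirror-In h⊑g m in-h) sum)
    where
    open ≡-Reasoning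
    x y : ℕ
    x = rev h i
    y = rev g x
    -- Adding x + i to both sides avoids subtraction.
    sum : y + rev g i ≡ p h′ + q h′
    sum = +-cancelʳ-≡ (x + i) _ _ (begin
      (y + rev g i) + (x + i)          ≡⟨ interchange +-commutativeSemigroup y (rev g i) x i ⟩
      (y + x) + (rev g i + i)          ≡⟨ cong₂ _+_ (rev-sum g (⊑-In h⊑g (rev-In h in-h))) (rev-sum g (⊑-In h⊑g in-h)) ⟩
      (p g + q g) + (p g + q g)        ≡⟨ cong₂ _+_ (Mirror.lower m) (Mirror.upper m) ⟨
      (p h′ + q h) + (q h′ + p h)      ≡⟨ interchange +-commutativeSemigroup (p h′) (q h) (q h′) (p h) ⟩
      (p h′ + q h′) + (q h + p h)      ≡⟨ cong ((p h′ + q h′) +_) (trans (+-comm (q h) (p h)) (sym (rev-sum h in-h))) ⟩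
      (p h′ + q h′) + (x + i)          ∎)

  -- The action of words on points, and congruence of concatenation

  act-++ : ∀ (u v : Word n) i → act (u ++ v) i ≡ act u (act v i)
  act-++ []      v i = refl
  act-++ (g ∷ u) v i = cong (rev g) (act-++ u v i)

  act-rel : ∀ {l r : Word n} → Rel l r → ∀ i → act l i ≡ act r i
  act-rel (j1 g) i = rev-involutive g i
  act-rel (j2 g h g∥h) i = rev-comm-∥ {g} {h} ([ before , after ]′ g∥h) i
  act-rel (j3 g h h′ a b c d) i = rev-mirror {g} {h} {h′} (a , b) (c , d) i

  act-≈ : ∀ {u v : Word n} → u ≈ v → ∀ i → act u i ≡ act v i
  act-≈ ≈-refl i = refl
  act-≈ (≈-sym e) i = sym (act-≈ e i)
  act-≈ (≈-trans e f) i = trans (act-≈ e i) (act-≈ f i)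
  act-≈ (≈-rel u v {l} {r} x) i = begin
    act (u ++ l ++ v) i        ≡⟨ act-++ u (l ++ v) i ⟩
    act u (act (l ++ v) i)     ≡⟨ cong (act u) (act-++ l v i) ⟩
    act u (act l (act v i))    ≡⟨ cong (act u) (act-rel x (act v i)) ⟩
    act u (act r (act v i))    ≡⟨ cong (act u) (act-++ r v i) ⟨
    act u (act (r ++ v) i)     ≡⟨ act-++ u (r ++ v) i ⟨
    act (u ++ r ++ v) i        ∎
    where open ≡-Reasoning

  ≈-++ˡ : ∀ (u : Word n) {v w} → v ≈ w → u ++ v ≈ u ++ w
  ≈-++ˡ u ≈-refl = ≈-refl
  ≈-++ˡ u (≈-sym e) = ≈-sym (≈-++ˡ u e)
  ≈-++ˡ u (≈-trans e f) = ≈-trans (≈-++ˡ u e) (≈-++ˡ u f)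
  ≈-++ˡ u (≈-rel a b {l} {r} x) =
    subst₂ _≈_ (++-assoc u a (l ++ b)) (++-assoc u a (r ++ b)) (≈-rel (u ++ a) b x)

  ≈-++ʳ : ∀ (u : Word n) {v w} → v ≈ w → v ++ u ≈ w ++ u
  ≈-++ʳ u ≈-refl = ≈-refl
  ≈-++ʳ u (≈-sym e) = ≈-sym (≈-++ʳ u e)
  ≈-++ʳ u (≈-trans e f) = ≈-trans (≈-++ʳ u e) (≈-++ʳ u f)
  ≈-++ʳ u (≈-rel a b {l} {r} x) = subst₂ _≈_ (shift l) (shift r) (≈-rel a (b ++ u) x)
    where
    shift : ∀ m → a ++ m ++ b ++ u ≡ (a ++ m ++ b) ++ u
    shift m = sym (trans (++-assoc a (m ++ b) u) (cong (a ++_) (++-assoc m b u)))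

-- Intervals as letters of a right-angled Coxeter group

-- Position i of the vector stands for the integer i, so position 0 is never used by a generator.
Subset : ℕ → Set
Subset n = Vec Bool (suc n)

module _ {n : ℕ} where

  -- Defined for all subsets, because a reversal can take an interval to a subset that is not an
  -- interval.
  data Com (A B : Subset n) : Set where
    sub   : (∀ i → lookup A i ≡ true → lookup B i ≡ true) → Com A B
    sup   : (∀ i → lookup B i ≡ true → lookup A i ≡ true) → Com A B
    apart : (∀ i → lookup A i ≡ true → lookup B i ≡ false) → Com A B

  opaque
    com? : ∀ A B → Dec (Com A B)
    com? A B = map′
      (λ { (inj₁ s) → sub s ; (inj₂ (inj₁ s)) → sup s ; (inj₂ (inj₂ s)) → apart s })
      (λ { (sub s) → inj₁ s ; (sup s) → inj₂ (inj₁ s) ; (apart s) → inj₂ (inj₂ s) })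
      (all? (λ i → (lookup A i ≟ᵇ true) →-dec (lookup B i ≟ᵇ true)) ⊎-dec
       all? (λ i → (lookup B i ≟ᵇ true) →-dec (lookup A i ≟ᵇ true)) ⊎-dec
       all? (λ i → (lookup A i ≟ᵇ true) →-dec (lookup B i ≟ᵇ false)))

  com-refl : ∀ A → Com A A
  com-refl A = sub λ _ e → e

  com-sym : ∀ {A B} → Com A B → Com B A
  com-sym (sub s) = sup s
  com-sym (sup s) = sub s
  com-sym {A} {B} (apart s) = apart flip
    where
    flip : ∀ i → lookup B i ≡ true → lookup A i ≡ false
    flip i e with lookup A i in e′
    ... | false = refl
    ... | true  = contradiction (trans (sym e) (s i e′)) λ ()

  open TraceWords (≡-dec _≟ᵇ_) Com com? com-refl com-sym public

  rev-≤ : ∀ g {i} → i ≤ n → rev g i ≤ n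
  rev-≤ g {i} i≤n with In? g i
  ... | yes in-g = ≤-trans (In.upper (rev-In g in-g)) (q≤n g)
  ... | no ¬in   = ≤-trans (≤-reflexive (rev-out g ¬in)) i≤n

  revF : Gen n → Fin (suc n) → Fin (suc n)
  revF g i = fromℕ< (s≤s (rev-≤ g (s≤s⁻¹ (toℕ<n i))))

  toℕ-revF : ∀ g i → toℕ (revF g i) ≡ rev g (toℕ i)
  toℕ-revF g i = toℕ-fromℕ< _

  opaque
    -- The image of `A` under the reversal; precomposition computes it because a reversal is its own
    -- inverse.
    σ : Gen n → Subset n → Subset n
    σ g A = tabulate λ i → lookup A (revF g i)

    lookup-σ : ∀ g A i → lookup (σ g A) i ≡ lookup A (revF g i)
    lookup-σ g A i = lookup∘tabulate (λ i → lookup A (revF g i)) i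

  lookup-ext : {A B : Subset n} → (∀ i → lookup A i ≡ lookup B i) → A ≡ B
  lookup-ext {A} {B} e =
    trans (sym (tabulate∘lookup A)) (trans (tabulate-cong e) (tabulate∘lookup B))

  revF-involutive : ∀ g i → revF g (revF g i) ≡ i
  revF-involutive g i = toℕ-injective (trans (toℕ-revF g _)
    (trans (cong (rev g) (toℕ-revF g i)) (rev-involutive g (toℕ i))))

  σ-involutive : ∀ g A → σ g (σ g A) ≡ A
  σ-involutive g A = lookup-ext λ i → trans (lookup-σ g (σ g A) i)
    (trans (lookup-σ g A _) (cong (lookup A) (revF-involutive g i)))

  σ-com : ∀ g {A B} → Com A B → Com (σ g A) (σ g B)
  σ-com g {A} {B} (sub s) = sub λ i e → trans (lookup-σ g B i) (s _ (trans (sym (lookup-σ g A i)) e))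
  σ-com g {A} {B} (sup s) = sup λ i e → trans (lookup-σ g A i) (s _ (trans (sym (lookup-σ g B i)) e))
  σ-com g {A} {B} (apart s) = apart λ i e → trans (lookup-σ g B i) (s _ (trans (sym (lookup-σ g A i)) e))

  module σ-Aut (g : Gen n) = Automorphism (σ g) (σ-involutive g) (σ-com g)

  -- σ is contravariant on positions: σ g ∘ σ h precomposes with rev h ∘ rev g.
  σ-comp : ∀ g h g′ h′ → (∀ i → rev h (rev g i) ≡ rev h′ (rev g′ i)) →
           ∀ A → σ g (σ h A) ≡ σ g′ (σ h′ A)
  σ-comp g h g′ h′ e A = lookup-ext λ i → begin
    lookup (σ g (σ h A)) i           ≡⟨ lookup-σ g _ i ⟩
    lookup (σ h A) (revF g i)        ≡⟨ lookup-σ h A _ ⟩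
    lookup A (revF h (revF g i))     ≡⟨ cong (lookup A) (toℕ-injective (pointwise i)) ⟩
    lookup A (revF h′ (revF g′ i))   ≡⟨ lookup-σ h′ A _ ⟨
    lookup (σ h′ A) (revF g′ i)      ≡⟨ lookup-σ g′ _ i ⟨
    lookup (σ g′ (σ h′ A)) i         ∎
    where
    open ≡-Reasoning
    expand : ∀ x y i → toℕ (revF y (revF x i)) ≡ rev y (rev x (toℕ i))
    expand x y i = trans (toℕ-revF y _) (cong (rev y) (toℕ-revF x i))
    pointwise : ∀ i → toℕ (revF h (revF g i)) ≡ toℕ (revF h′ (revF g′ i))
    pointwise i = trans (expand g h i) (trans (e (toℕ i)) (sym (expand g′ h′ i)))

  opaque
    ⟦_⟧ : Gen n → Subset n
    ⟦ g ⟧ = tabulate λ i → does (In? g (toℕ i))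

    lookup-⟦⟧ : ∀ g i → lookup ⟦ g ⟧ i ≡ does (In? g (toℕ i))
    lookup-⟦⟧ g i = lookup∘tabulate (λ i → does (In? g (toℕ i))) i

  In⇒true : ∀ {g i} → In g (toℕ i) → lookup ⟦ g ⟧ i ≡ true
  In⇒true {g} {i} x = trans (lookup-⟦⟧ g i) (dec-true (In? g (toℕ i)) x)

  ¬In⇒false : ∀ {g i} → ¬ In g (toℕ i) → lookup ⟦ g ⟧ i ≡ false
  ¬In⇒false {g} {i} x = trans (lookup-⟦⟧ g i) (dec-false (In? g (toℕ i)) x)

  true⇒In : ∀ {g i} → lookup ⟦ g ⟧ i ≡ true → In g (toℕ i)
  true⇒In {g} {i} e with In? g (toℕ i)
  ... | yes x = x
  ... | no ¬x = contradiction (trans (sym e) (¬In⇒false ¬x)) λ ()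

  σ-⟦⟧ : ∀ {g h k} → (∀ {i} → In h (rev g i) → In k i) → (∀ {i} → In k i → In h (rev g i)) →
         σ g ⟦ h ⟧ ≡ ⟦ k ⟧
  σ-⟦⟧ {g} {h} {k} to from = lookup-ext pointwise
    where
    pointwise : ∀ i → lookup (σ g ⟦ h ⟧) i ≡ lookup ⟦ k ⟧ i
    pointwise i with In? k (toℕ i)
    ... | yes x = trans (lookup-σ g ⟦ h ⟧ i)
      (trans (In⇒true (subst (In h) (sym (toℕ-revF g i)) (from x))) (sym (In⇒true x)))
    ... | no ¬x = trans (lookup-σ g ⟦ h ⟧ i)
      (trans (¬In⇒false λ y → ¬x (to (subst (In h) (toℕ-revF g i) y))) (sym (¬In⇒false ¬x)))

  σ-⊑ : ∀ {g h} → g ⊑ h → σ g ⟦ h ⟧ ≡ ⟦ h ⟧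
  σ-⊑ {g} {h} g⊑h = σ-⟦⟧ (λ {i} x → subst (In h) (rev-involutive g i) (stays x)) stays
    where
    stays : ∀ {i} → In h i → In h (rev g i)
    stays {i} x with In? g i
    ... | yes y = ⊑-In g⊑h (rev-In g y)
    ... | no ¬y = subst (In h) (sym (rev-out g ¬y)) x

  σ-self : ∀ g → σ g ⟦ g ⟧ ≡ ⟦ g ⟧
  σ-self g = σ-⊑ (≤-refl , ≤-refl)

  σ-∥ : ∀ {g h} → g ∥ h → σ g ⟦ h ⟧ ≡ ⟦ h ⟧
  σ-∥ {g} {h} g∥h = σ-⟦⟧ (λ {i} x → subst (In h) (rev-involutive g i) (stays x)) stays
    where
    stays : ∀ {i} → In h i → In h (rev g i)
    stays x = subst (In h) (sym (rev-∥ g∥h x)) x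

  σ-mirror : ∀ {g h h′} → h ⊑ g → Mirror g h h′ → σ g ⟦ h ⟧ ≡ ⟦ h′ ⟧
  σ-mirror {g} {h} {h′} h⊑g m = σ-⟦⟧
    (λ {i} x → subst (In h′) (rev-involutive g i) (mirror-In h⊑g m x))
    (mirror-In (mirror-⊑ h⊑g m) (mirror-sym m))

  ⊑⇒com : ∀ {g h} → g ⊑ h → Com ⟦ g ⟧ ⟦ h ⟧
  ⊑⇒com g⊑h = sub λ _ e → In⇒true (⊑-In g⊑h (true⇒In e))

  ∥⇒com : ∀ {g h} → g ∥ h → Com ⟦ g ⟧ ⟦ h ⟧
  ∥⇒com g∥h = apart λ _ e → ¬In⇒false λ x → ∥⇒¬In g∥h x (true⇒In e)

  private
    at : ∀ {i} → i ≤ n → ∃ λ (j : Fin (suc n)) → toℕ j ≡ i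
    at i≤n = fromℕ< (s≤s i≤n) , toℕ-fromℕ< _

    transfer : ∀ {g h i} → (∀ j → lookup ⟦ g ⟧ j ≡ true → lookup ⟦ h ⟧ j ≡ true) → In g i → In h i
    transfer {g} s x@(_ , i≤q) with at (≤-trans i≤q (q≤n g))
    ... | j , refl = true⇒In (s j (In⇒true x))

    meet : ∀ {g h i} → (∀ j → lookup ⟦ g ⟧ j ≡ true → lookup ⟦ h ⟧ j ≡ false) → In g i → ¬ In h i
    meet {g} s x@(_ , i≤q) y with at (≤-trans i≤q (q≤n g))
    ... | j , refl = contradiction (trans (sym (In⇒true y)) (s j (In⇒true x))) λ ()

    ⊆⇒⊑ : ∀ {g h} → (∀ j → lookup ⟦ g ⟧ j ≡ true → lookup ⟦ h ⟧ j ≡ true) → g ⊑ h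
    ⊆⇒⊑ {g} s = In.lower (transfer s (≤-refl , p≤q g)) , In.upper (transfer s (p≤q g , ≤-refl))

  data Compat (g h : Gen n) : Set where
    inside  : g ⊑ h → Compat g h
    around  : h ⊑ g → Compat g h
    outside : g ∥ h → Compat g h

  -- If neither interval lies before the other, the larger of the two left endpoints belongs to
  -- both. Each resulting case is covered by (j2) or (j3), which is why commutations lift.
  com⇒compat : ∀ {g h} → Com ⟦ g ⟧ ⟦ h ⟧ → Compat g h
  com⇒compat (sub s) = inside (⊆⇒⊑ s)
  com⇒compat (sup s) = around (⊆⇒⊑ s)
  com⇒compat {g} {h} (apart s) with q g <? p h | q h <? p g
  ... | yes a | _     = outside (before a)
  ... | no _  | yes b = outside (after b)
  ... | no a  | no b with ≤-total (p g) (p h)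
  ...   | inj₁ pg≤ph = contradiction (≤-refl , p≤q h) (meet s (pg≤ph , ≮⇒≥ a))
  ...   | inj₂ ph≤pg = contradiction (ph≤pg , ≮⇒≥ b) (meet s (≤-refl , p≤q g))

  ⟦⟧-injective : ∀ {g h} → ⟦ g ⟧ ≡ ⟦ h ⟧ → g ≡ h
  ⟦⟧-injective e = ⊑-antisym
    (⊆⇒⊑ λ j x → trans (cong (λ A → lookup A j) (sym e)) x)
    (⊆⇒⊑ λ j x → trans (cong (λ A → lookup A j) e) x)

  data Cross (g h : Gen n) : Set where
    left  : p g < p h → p h ≤ q g → q g < q h → Cross g h
    right : p h < p g → p g ≤ q h → q h < q g → Cross g h

  cross⇒¬com : ∀ {g h} → Cross g h → ¬ Com ⟦ g ⟧ ⟦ h ⟧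
  cross⇒¬com (left a b c) com with com⇒compat com
  ... | inside  (x , _)  = <⇒≱ a x
  ... | around  (_ , x)  = <⇒≱ c x
  ... | outside (before x) = <⇒≱ x b
  ... | outside (after x)  = <⇒≱ x (<⇒≤ (<-≤-trans a (≤-trans b (<⇒≤ c))))
  cross⇒¬com (right a b c) com with com⇒compat com
  ... | inside  (_ , x)  = <⇒≱ c x
  ... | around  (x , _)  = <⇒≱ a x
  ... | outside (after x) = <⇒≱ x b
  ... | outside (before x)  = <⇒≱ x (<⇒≤ (<-≤-trans a (≤-trans b (<⇒≤ c))))

  cross-sym : ∀ {g h} → Cross g h → Cross h g
  cross-sym (left a b c)  = right a b c
  cross-sym (right a b c) = left a b c

-- Length and descents in the cactus group

module _ {n : ℕ} where

  -- Left multiplication by the image of `g` in the semidirect product, seen on the Coxeter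
  -- component: `rev g` relabels the word, then the letter of `g` is multiplied in.
  step : Gen n → List (Subset n) → List (Subset n)
  step g u = insert ⟦ g ⟧ (map (σ g) u)

  step-~ : ∀ g {u v} → u ~ v → step g u ~ step g v
  step-~ g e = insert-~ ⟦ g ⟧ (σ-Aut.map-~ g e)

  step-reduced : ∀ g {u} → Reduced u → Reduced (step g u)
  step-reduced g r = insert-reduced ⟦ g ⟧ (σ-Aut.reduced-map g r)

  step-step : ∀ g h u → step g (step h u) ~ insert ⟦ g ⟧ (insert (σ g ⟦ h ⟧) (map (σ g) (map (σ h) u)))
  step-step g h u = insert-~ ⟦ g ⟧ (σ-Aut.map-insert g ⟦ h ⟧ (map (σ h) u))

  step-involutive : ∀ g {u} → Reduced u → step g (step g u) ~ u
  step-involutive g {u} r = ~-trans (step-step g g u)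
    (subst₂ (λ A v → insert ⟦ g ⟧ (insert A v) ~ u) (sym (σ-self g)) (sym (σ-Aut.map-involutive g u))
      (insert-involutive ⟦ g ⟧ r))

  -- Treats (j2) and (j3) together: both sides relabel by the same permutation and insert the
  -- commuting letters `⟦ g ⟧` and `⟦ h′ ⟧`, in opposite orders.
  step-comm : ∀ g h h′ g′ u → σ g ⟦ h ⟧ ≡ ⟦ h′ ⟧ → σ h′ ⟦ g′ ⟧ ≡ ⟦ g ⟧ → Com ⟦ g ⟧ ⟦ h′ ⟧ →
              (∀ A → σ g (σ h A) ≡ σ h′ (σ g′ A)) → step g (step h u) ~ step h′ (step g′ u)
  step-comm g h h′ g′ u e f c comp = ~-trans (step-step g h u) (~-trans
    (subst₂ (λ A v → insert ⟦ g ⟧ (insert (σ g ⟦ h ⟧) (map (σ g) (map (σ h) u))) ~ insert A (insert ⟦ g ⟧ v))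
      e maps (insert-comm (map (σ g) (map (σ h) u)) (subst (Com ⟦ g ⟧) (sym e) c)))
    (~-sym (subst (λ A → step h′ (step g′ u) ~ insert ⟦ h′ ⟧ (insert A (map (σ h′) (map (σ g′) u)))) f
      (step-step h′ g′ u))))
    where
    maps : map (σ g) (map (σ h) u) ≡ map (σ h′) (map (σ g′) u)
    maps = trans (sym (map-∘ u)) (trans (map-cong comp u) (map-∘ u))

  step-rel : ∀ {l r : Word n} {u} → Rel l r → Reduced u → foldr step u l ~ foldr step u r
  step-rel (j1 g) red = step-involutive g red
  step-rel {u = u} (j2 g h d) _ =
    step-comm g h h g u (σ-∥ g∥h) (σ-∥ (∥-sym g∥h)) (∥⇒com g∥h) (σ-comp g h h g (rev-comm-∥ (∥-sym g∥h)))
    where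
    g∥h : g ∥ h
    g∥h = [ before , after ]′ d
  step-rel {u = u} (j3 g h h′ a b c d) _ =
    step-comm g h h′ g u (σ-mirror h⊑g m) (σ-⊑ h′⊑g) (com-sym (⊑⇒com h′⊑g))
      -- Because `σ` reverses the order of composition, the identity needed is the one with `h` and
      -- `h′` exchanged.
      (σ-comp g h h′ g λ i → sym (rev-mirror h′⊑g (mirror-sym m) i))
    where
    h⊑g : h ⊑ g
    h⊑g = a , b
    m : Mirror g h h′
    m = c , d
    h′⊑g : h′ ⊑ g
    h′⊑g = mirror-⊑ h⊑g m

  -- The Coxeter component of the image of `w`, as a reduced word; the permutation component is
  -- `act w`.
  N : Word n → List (Subset n)
  N = foldr step []

  N-reduced : ∀ w → Reduced (N w)
  N-reduced []      = []
  N-reduced (g ∷ w) = step-reduced g (N-reduced w)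

  N-≈ : ∀ {v w} → v ≈ w → N v ~ N w
  N-≈ ≈-refl = ~-refl
  N-≈ (≈-sym e) = ~-sym (N-≈ e)
  N-≈ (≈-trans e f) = ~-trans (N-≈ e) (N-≈ f)
  N-≈ (≈-rel u v {l} {r} x) = prefix u
    where
    prefix : ∀ u → N (u ++ l ++ v) ~ N (u ++ r ++ v)
    prefix [] = subst₂ _~_ (sym (foldr-++ step [] l v)) (sym (foldr-++ step [] r v))
                  (step-rel x (N-reduced v))
    prefix (g ∷ u) = step-~ g (prefix u)

  ℓ : Word n → ℕ
  ℓ w = length (N w)

  ℓ-≈ : ∀ {v w} → v ≈ w → ℓ v ≡ ℓ w
  ℓ-≈ e = ~-length (N-≈ e)

  record Desc (g : Gen n) (w : Word n) : Set where
    constructor desc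
    field
      descent : Descent ⟦ g ⟧ (N w)

  open Desc

  desc? : ∀ g w → Dec (Desc g w)
  desc? g w = map′ desc descent (descent? ⟦ g ⟧ (N w))

  desc-≈ : ∀ {g v w} → v ≈ w → Desc g v → Desc g w
  desc-≈ e d = desc (descent-~ (N-≈ e) (descent d))

  -- `σ g` fixes `⟦ g ⟧`, so relabelling the word by `σ g` does not change whether this letter is a
  -- descent.
  N-ascent : ∀ {g w} → ¬ Desc g w → N (g ∷ w) ≡ ⟦ g ⟧ ∷ map (σ g) (N w)
  N-ascent {g} {w} ¬d = insert-ascent λ d →
    ¬d (desc (subst (λ A → Descent A (N w)) (σ-self g) (σ-Aut.descent-map⁻ g d)))

  desc-ascent : ∀ {g w} → ¬ Desc g w → Desc g (g ∷ w)
  desc-ascent {g} ¬d = desc (subst (Descent ⟦ g ⟧) (sym (N-ascent ¬d)) (_ , here))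

  ℓ-ascent : ∀ {g w} → ¬ Desc g w → ℓ (g ∷ w) ≡ suc (ℓ w)
  ℓ-ascent {g} {w} ¬d = trans (cong length (N-ascent ¬d)) (cong suc (length-map (σ g) (N w)))

  ℓ-descent : ∀ {g w} → Desc g w → suc (ℓ (g ∷ w)) ≡ ℓ w
  ℓ-descent {g} {w} (desc (u , d)) = trans (cong suc (~-length (insert-descent d′)))
    (trans (sym (~-length (del-front d′))) (length-map (σ g) (N w)))
    where
    d′ : Del ⟦ g ⟧ (map (σ g) (N w)) (map (σ g) u)
    d′ = subst (λ A → Del A (map (σ g) (N w)) (map (σ g) u)) (σ-self g) (σ-Aut.map-del g d)

  ℓ-∷-≤ : ∀ g w → ℓ (g ∷ w) ≤ suc (ℓ w)
  ℓ-∷-≤ g w with desc? g w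
  ... | yes d = ≤-trans (n≤1+n _) (≤-trans (≤-reflexive (ℓ-descent d)) (n≤1+n _))
  ... | no ¬d = ≤-reflexive (ℓ-ascent ¬d)

  ℓ≤length : ∀ w → ℓ w ≤ length w
  ℓ≤length []      = z≤n
  ℓ≤length (g ∷ w) = ≤-trans (ℓ-∷-≤ g w) (s≤s (ℓ≤length w))

  -- As `ℓ` is invariant under `≈` and bounded by the word length, such a word is a shortest one in
  -- its class.
  record Geodesic (w : Word n) : Set where
    constructor geodesic
    field
      ℓ≡length : ℓ w ≡ length w

  geodesic-ascent : ∀ {g w} → Geodesic (g ∷ w) → ¬ Desc g w
  geodesic-ascent {g} {w} (geodesic e) d =
    <⇒≱ (≤-trans (n≤1+n _) (≤-reflexive (trans (cong suc (sym e)) (ℓ-descent d)))) (ℓ≤length w)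

  geodesic-tail : ∀ {g w} → Geodesic (g ∷ w) → Geodesic w
  geodesic-tail geo@(geodesic e) = geodesic (suc-injective (trans (sym (ℓ-ascent (geodesic-ascent geo))) e))

  geodesic-≈ : ∀ {v w} → v ≈ w → length v ≡ length w → Geodesic v → Geodesic w
  geodesic-≈ v≈w len (geodesic e) = geodesic (trans (sym (ℓ-≈ v≈w)) (trans e len))

  -- Lifts a commutation of letters to the cactus group. Behind `k`, the generator with letter
  -- `⟦ h ⟧` appears as `h′`; moving it to the front turns `k` into `k′`, by (j2) if disjoint and by
  -- (j3) if nested.
  slide : ∀ {h k : Gen n} → Compat h k → ∃₂ λ h′ k′ → σ k ⟦ h ⟧ ≡ ⟦ h′ ⟧ × (∀ w → k ∷ h′ ∷ w ≈ h ∷ k′ ∷ w)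
  slide {h} {k} (outside (before a)) = h , k , σ-∥ (after a) , λ w → ≈-rel [] w (j2 k h (inj₂ a))
  slide {h} {k} (outside (after a)) = h , k , σ-∥ (before a) , λ w → ≈-rel [] w (j2 k h (inj₁ a))
  slide {h} {k} (inside h⊑k) with mirror k h h⊑k
  ... | h′ , m with mirror-⊑ h⊑k m | mirror-sym m
  ...   | a , b | c , d = h′ , k , σ-mirror h⊑k m , λ w → ≈-rel [] w (j3 k h′ h a b c d)
  slide {h} {k} (around k⊑h) with mirror h k k⊑h
  ... | k′ , m with mirror-⊑ k⊑h m | mirror-sym m
  ...   | a , b | c , d = h , k′ , σ-⊑ k⊑h , λ w → ≈-sym (≈-rel [] w (j3 h k′ k a b c d))

  -- A descent seen in the Coxeter group is a genuine first letter in the cactus group: it is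
  -- brought to the front of the tail by induction and then slid across `k`.
  geodesic-front : ∀ {h} w → Geodesic w → Desc h w → ∃ λ v → w ≈ h ∷ v × suc (length v) ≡ length w
  geodesic-front [] _ (desc ())
  geodesic-front {h} (k ∷ w) geo (desc d)
    with descent-∷ (subst (Descent ⟦ h ⟧) (N-ascent (geodesic-ascent geo)) d)
  ... | inj₁ e = w , subst (λ x → k ∷ w ≈ x ∷ w) (sym (⟦⟧-injective e)) ≈-refl , refl
  ... | inj₂ (c , d′) with slide (com⇒compat c)
  ...   | h′ , k′ , e , sl
      with geodesic-front w (geodesic-tail geo)
             (desc (subst (λ A → Descent A (N w)) e (σ-Aut.descent-map⁻ k d′)))
  ...     | v , w≈ , len = k′ ∷ v , ≈-trans (≈-++ˡ (k ∷ []) w≈) (sl v) , cong suc len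

  -- If the new letter is a descent, it can be brought to the front of the geodesic tail, where (j1)
  -- cancels the pair.
  geodesic-form : ∀ w → ∃ λ v → w ≈ v × Geodesic v
  geodesic-form [] = [] , ≈-refl , geodesic refl
  geodesic-form (h ∷ w) with geodesic-form w
  ... | v , w≈v , geo@(geodesic eq) with desc? h v
  ...   | no ¬d = h ∷ v , ≈-++ˡ (h ∷ []) w≈v , geodesic (trans (ℓ-ascent ¬d) (cong suc eq))
  ...   | yes d with geodesic-front v geo d
  ...     | u , v≈hu , len = u , hw≈u , geodesic (suc-injective
    (trans (cong suc (sym (ℓ-≈ hv≈u))) (trans (ℓ-descent d) (trans eq (sym len)))))
    where
    hv≈u : h ∷ v ≈ u
    hv≈u = ≈-trans (≈-++ˡ (h ∷ []) v≈hu) (≈-rel [] u (j1 h))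
    hw≈u : h ∷ w ≈ u
    hw≈u = ≈-trans (≈-++ˡ (h ∷ []) w≈v) hv≈u

  -- Length-additive products and failure to commute

  Reaches : Gen n → Word n → Word n → Set
  Reaches g u w = Desc g (u ++ w) × ℓ (u ++ w) ≡ length u + ℓ w

  reaches-ascent : ∀ {g u w} → ¬ Desc g (u ++ w) → ℓ (u ++ w) ≡ length u + ℓ w → Reaches g (g ∷ u) w
  reaches-ascent ¬d e = desc-ascent ¬d , trans (ℓ-ascent ¬d) (cong suc e)

  cross⇒¬desc : ∀ {g a w} → Cross g a → Desc a w → ¬ Desc g w
  cross⇒¬desc c (desc d) (desc e) = cross⇒¬com c (descents-commute e d)

  -- Descents never cross, so `g` is not a descent while `a` is one; prepending `g` therefore adds
  -- to the length.
  reaches-cross : ∀ {g a u w} → Cross g a → Reaches a u w → Reaches g (g ∷ u) w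
  reaches-cross {u = u} c (d , e) = reaches-ascent {u = u} (cross⇒¬desc c d) e

  -- For the middle of the probe, where `g` meets `g′` without crossing it. If `g` were a descent
  -- after `g′`, then, since `σ g′` fixes its letter, it would already be one before, next to the
  -- crossing descent `a`.
  reaches-two : ∀ {g g′ a u w} → Cross g a → Cross g′ a → g ≢ g′ → σ g′ ⟦ g ⟧ ≡ ⟦ g ⟧ →
                Reaches a u w → Reaches g (g ∷ g′ ∷ u) w
  reaches-two {g} {g′} {a} {u} {w} c c′ g≢g′ fix r@(d , _) =
    reaches-ascent {u = g′ ∷ u} ¬d (proj₂ (reaches-cross {u = u} c′ r))
    where
    ¬d : ¬ Desc g (g′ ∷ u ++ w)
    ¬d (desc e) with descent-∷ (subst (Descent ⟦ g ⟧) (N-ascent (cross⇒¬desc c′ d)) e)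
    ... | inj₁ eq = g≢g′ (⟦⟧-injective eq)
    ... | inj₂ (_ , e′) = cross⇒¬desc c d
      (desc (subst (λ A → Descent A (N (u ++ w))) fix (σ-Aut.descent-map⁻ g′ e′)))

  alternate : ℕ → Gen n → Gen n → Word n → Word n
  alternate zero    a b u = u
  alternate (suc k) a b u = a ∷ b ∷ alternate k a b u

  reaches-alternate : ∀ k {a b u w} → Cross b a → Reaches a u w → Reaches a (alternate k a b u) w
  reaches-alternate zero c r = r
  reaches-alternate (suc k) {a} {b} {u} c r =
    reaches-cross {u = b ∷ alternate k a b u} (cross-sym c)
      (reaches-cross {u = alternate k a b u} c (reaches-alternate k c r))

  -- If `a` is not a descent of `w ++ v`, it is one of the common product, as is the crossing `g`.
  -- Otherwise prepending `a` to `w ++ v` cancels, which makes the product shorter than additivity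
  -- on the other side demands.
  not-central : ∀ {a w v g} → Geodesic (a ∷ w) → Cross g a → Reaches g v (a ∷ w) →
                ¬ ((a ∷ w) ++ v ≈ v ++ (a ∷ w))
  not-central {a} {w} {v} {g} (geodesic geo) c (d , e) comm with desc? a (w ++ v)
  ... | no ¬d = cross⇒¬desc c (desc-≈ comm (desc-ascent ¬d)) d
  ... | yes d′ = <⇒≱ short (≤-trans (ℓ≤length (w ++ v)) (≤-reflexive (length-++ w)))
    where
    open ≤-Reasoning
    short : length w + length v < ℓ (w ++ v)
    short = begin-strict
      length w + length v                 ≡⟨ +-comm (length w) (length v) ⟩
      length v + length w                 <⟨ +-monoʳ-< (length v) (n<1+n _) ⟩
      length v + length (a ∷ w)           ≡⟨ cong (length v +_) geo ⟨
      length v + ℓ (a ∷ w)                ≡⟨ e ⟨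
      ℓ (v ++ a ∷ w)                      ≡⟨ ℓ-≈ comm ⟨
      ℓ (a ∷ w ++ v)                      <⟨ n<1+n _ ⟩
      suc (ℓ (a ∷ w ++ v))                ≡⟨ ℓ-descent d′ ⟩
      ℓ (w ++ v)                          ∎

  geodesic-desc : ∀ {a w} → Geodesic (a ∷ w) → Desc a (a ∷ w)
  geodesic-desc geo = desc-ascent (geodesic-ascent geo)

  record Full (t : Gen n) : Set where
    constructor _,_
    field
      starts : p t ≡ 1
      ends   : q t ≡ n

  ⊑-full : ∀ {t} → Full t → ∀ h → h ⊑ t
  ⊑-full (a , b) h = ≤-trans (≤-reflexive a) (1≤p h) , ≤-trans (q≤n h) (≤-reflexive (sym b))

  -- In a geodesic `t ∷ b ∷ u` with `t` full, (j3) carries `t` past `b` and puts the mirror image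
  -- `b′` first. Then `b′` is full too, so `b` equals `t`, and the word begins with a cancelling
  -- pair.
  trivial-if-full : (Z : Word n → Set) → (∀ {v w} → v ≈ w → Z v → Z w) →
    (∀ {a w} → Geodesic (a ∷ w) → Z (a ∷ w) → Full a) → (∀ {t} → Full t → ¬ Z (t ∷ [])) →
    ∀ w → Z w → w ≈ []
  trivial-if-full Z Z-≈ first ¬top w z with geodesic-form w
  ... | [] , w≈ , _ = w≈
  ... | t ∷ [] , w≈ , geo = contradiction (Z-≈ w≈ z) (¬top (first geo (Z-≈ w≈ z)))
  ... | t ∷ b ∷ u , w≈ , geo = contradiction t≡b t≢b
    where
    full : Full t
    full = first geo (Z-≈ w≈ z)
    b⊑t : b ⊑ t
    b⊑t = ⊑-full full b
    t≢b : t ≢ b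
    t≢b refl = geodesic-ascent geo (geodesic-desc (geodesic-tail geo))
    b′ : Gen n
    b′ = proj₁ (mirror t b b⊑t)
    m : Mirror t b b′
    m = proj₂ (mirror t b b⊑t)
    turn : t ∷ b ∷ u ≈ b′ ∷ t ∷ u
    turn = ≈-rel [] u (j3 t b b′ (_⊑_.lower b⊑t) (_⊑_.upper b⊑t) (Mirror.lower m) (Mirror.upper m))
    full′ : Full b′
    full′ = first (geodesic-≈ turn refl geo) (Z-≈ (≈-trans w≈ turn) z)
    b′≡t : b′ ≡ t
    b′≡t = Gen-≡ (trans (Full.starts full′) (sym (Full.starts full)))
                 (trans (Full.ends full′) (sym (Full.ends full)))
    -- The involution `σ t` sends both letters to `⟦ t ⟧`.
    t≡b : t ≡ b
    t≡b = ⟦⟧-injective (trans (sym (σ-self t)) (trans (cong (σ t) (sym (trans (σ-mirror b⊑t m) (cong ⟦_⟧ b′≡t))))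
            (σ-involutive t ⟦ b ⟧)))

-- Periods of injections on a bounded range

iterate : (ℕ → ℕ) → ℕ → ℕ → ℕ
iterate f zero    i = i
iterate f (suc k) i = f (iterate f k i)

iterate-+ : ∀ f j k i → iterate f (j + k) i ≡ iterate f j (iterate f k i)
iterate-+ f zero    k i = refl
iterate-+ f (suc j) k i = cong f (iterate-+ f j k i)

iterate-* : ∀ f c {d i} → iterate f d i ≡ i → iterate f (c * d) i ≡ i
iterate-* f zero    e = refl
iterate-* f (suc c) {d} {i} e =
  trans (iterate-+ f d (c * d) i) (trans (cong (iterate f d) (iterate-* f c e)) e)

iterate-injective : ∀ {f} → (∀ {x y} → f x ≡ f y → x ≡ y) → ∀ j {x y} → iterate f j x ≡ iterate f j y → x ≡ y
iterate-injective inj zero    e = e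
iterate-injective inj (suc j) e = iterate-injective inj j (inj e)

module _ {n : ℕ} {f : ℕ → ℕ} (inj : ∀ {x y} → f x ≡ f y → x ≡ y) (closed : ∀ {x} → x ≤ n → f x ≤ n) where

  iterate-closed : ∀ k {i} → i ≤ n → iterate f k i ≤ n
  iterate-closed zero    i≤n = i≤n
  iterate-closed (suc k) i≤n = closed (iterate-closed k i≤n)

  iterate-period : ∀ {i} → i ≤ n → ∃ λ d → suc d ≤ suc n × iterate f (suc d) i ≡ i
  -- The range 0 to `n` has `suc n` points, so two of the first `suc (suc n)` iterates agree;
  -- injectivity strips off the common iterations.
  iterate-period {i} i≤n with pigeonhole (n<1+n (suc n)) orbit
    where
    orbit : Fin (suc (suc n)) → Fin (suc n)
    orbit j = fromℕ< (s≤s (iterate-closed (toℕ j) i≤n))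
  ... | j , k , j<k , same with m≤n⇒∃[o]m+o≡n j<k
  ...   | d , e = d , bound , iterate-injective inj (toℕ j) back
    where
    e′ : toℕ j + suc d ≡ toℕ k
    e′ = trans (+-suc (toℕ j) d) e
    bound : suc d ≤ suc n
    bound = ≤-trans (≤-trans (m≤n+m (suc d) (toℕ j)) (≤-reflexive e′)) (s≤s⁻¹ (toℕ<n k))
    back : iterate f (toℕ j) (iterate f (suc d) i) ≡ iterate f (toℕ j) i
    back = trans (sym (iterate-+ f (toℕ j) (suc d) i)) (trans (cong (λ x → iterate f x i) e′)
      (trans (sym (toℕ-fromℕ< _)) (trans (cong toℕ (sym same)) (toℕ-fromℕ< _))))

  -- Each point has a period of at most `suc n`, which divides the factorial; the exponent is thus
  -- the same for all points and all injections.
  iterate-! : ∀ {i} → i ≤ n → iterate f (suc n !) i ≡ i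
  iterate-! {i} i≤n with iterate-period i≤n
  ... | d , le , e with ∣-trans (m∣m*n {suc d} (d !)) (m≤n⇒m!∣n! le)
  ...   | divides c eq = trans (cong (λ x → iterate f x i) eq) (iterate-* f c e)

-- Triviality of the centers

module _ {n : ℕ} where

  rev-injective : ∀ (g : Gen n) {x y} → rev g x ≡ rev g y → x ≡ y
  rev-injective g {x} {y} e =
    trans (sym (rev-involutive g x)) (trans (cong (rev g) e) (rev-involutive g y))

  -- One less than the common period, since the probe's middle `g ∷ g′` stands for one further
  -- factor `g a` and one further factor `a g′`, with `a a` cancelled.
  period : ℕ
  period = pred (suc n !)

  rev-rev-period : ∀ (g h : Gen n) {i} → i ≤ n → iterate (rev g ∘ rev h) (suc period) i ≡ i
  rev-rev-period g h {i} i≤n = trans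
    (cong (λ k → iterate (rev g ∘ rev h) k i) (suc-pred (suc n !) {{suc n !≢0}}))
    (iterate-! (λ e → rev-injective h (rev-injective g e)) (λ x≤n → rev-≤ g (rev-≤ h x≤n)) i≤n)

  act-alternate : ∀ k a b (u : Word n) i →
                  act (alternate k a b u) i ≡ iterate (rev a ∘ rev b) k (act u i)
  act-alternate zero    a b u i = refl
  act-alternate (suc k) a b u i = cong (rev a ∘ rev b) (act-alternate k a b u i)

  iterate-suc : ∀ f k i → iterate f k (f i) ≡ iterate f (suc k) i
  iterate-suc f zero    i = refl
  iterate-suc f (suc k) i = cong f (iterate-suc f k i)

  -- A reduced form of (g a)ᵐ (a g′)ᵐ, where m is a common period of all products of two reversals.
  probe : Gen n → Gen n → Gen n → Word n
  probe a g g′ = alternate period g a (g ∷ g′ ∷ alternate period a g′ [])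

  probe-pure : ∀ a g g′ → Pure n (probe a g g′)
  probe-pure a g g′ i _ i≤n = begin
    act (probe a g g′) i                       ≡⟨ act-alternate period g a _ i ⟩
    iterate f period (rev g (rev g′ (act (alternate period a g′ []) i)))
      ≡⟨ cong (λ x → iterate f period (rev g (rev g′ x))) (act-alternate period a g′ [] i) ⟩
    -- Putting the cancelled `a a` back between `g` and `g′` completes both powers to the full
    -- period.
    iterate f period (rev g (rev g′ y))        ≡⟨ cong (iterate f period ∘ rev g) (rev-involutive a _) ⟨
    iterate f period (f (f′ y))                ≡⟨ iterate-suc f period (f′ y) ⟩
    iterate f (suc period) (f′ y)              ≡⟨ cong (iterate f (suc period)) (rev-rev-period a g′ i≤n) ⟩
    iterate f (suc period) i                   ≡⟨ rev-rev-period g a i≤n ⟩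
    i                                          ∎
    where
    open ≡-Reasoning
    f f′ : ℕ → ℕ
    f  = rev g ∘ rev a
    f′ = rev a ∘ rev g′
    y : ℕ
    y = iterate f′ period i

  -- Intervals crossing a proper interval

  full-if : ∀ {a : Gen n} → ¬ (2 ≤ p a ⊎ q a < n) → Full a
  full-if {a} ¬side =
    ≤-antisym (≮⇒≥ (¬side ∘ inj₁)) (1≤p a) , ≤-antisym (q≤n a) (≮⇒≥ (¬side ∘ inj₂))

  -- `fixed` is arranged by taking `g′` inside `g` or disjoint from it.
  record CrossingPair (a : Gen n) : Set where
    constructor pair
    field
      {g g′} : Gen n
      cross  : Cross g a
      cross′ : Cross g′ a
      g≢g′   : g ≢ g′
      fixed  : σ g′ ⟦ g ⟧ ≡ ⟦ g ⟧

  -- Two adjacent points suffice: an endpoint of `a` and its neighbour outside `a`.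
  crossing : ∀ a → 2 ≤ p a ⊎ q a < n → ∃ λ g → Cross g a
  crossing a@(gen (suc (suc x)) _ _ p<q q≤n) (inj₁ (s≤s (s≤s _))) =
    gen (suc x) (suc (suc x)) (s≤s z≤n) ≤-refl (≤-trans (<⇒≤ p<q) q≤n) , left ≤-refl ≤-refl p<q
  crossing (gen (suc zero) _ _ _ _) (inj₁ (s≤s ()))
  crossing a (inj₂ q<n) =
    gen (q a) (suc (q a)) (≤-trans (1≤p a) (p≤q a)) ≤-refl q<n , right (p<q a) ≤-refl ≤-refl

  -- With room on both sides of `a`, one adjacent pair straddles each endpoint. With room on one
  -- side only, `g′` is an adjacent pair straddling that endpoint and `g` has one point more:
  -- outside `a` if two points are free there, inside `a` otherwise.
  crossing-pair : 3 < n → ∀ a → 2 ≤ p a ⊎ q a < n → CrossingPair a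
  crossing-pair 3<n a side with 2 ≤? p a | q a <? n
  ... | no x | no y with side
  ...   | inj₁ x′ = contradiction x′ x
  ...   | inj₂ y′ = contradiction y′ y
  crossing-pair 3<n a@(gen (suc (suc x)) _ _ p<q q≤n) side | yes (s≤s (s≤s _)) | yes y =
    pair {g = gen (suc x) (2 + x) (s≤s z≤n) ≤-refl (≤-trans (<⇒≤ p<q) q≤n)}
         {g′ = gen (q a) (suc (q a)) (≤-trans (1≤p a) (p≤q a)) ≤-refl y}
      (left ≤-refl ≤-refl p<q) (right p<q ≤-refl ≤-refl)
      (λ e → <⇒≢ (<-trans (n<1+n _) p<q) (cong p e)) (σ-∥ (after p<q))
  -- Here `a` is [2,n], so `g` has to grow into `a`; `3 < n` keeps [1,3] from containing `a`.
  crossing-pair 3<n a@(gen (suc (suc zero)) _ _ p<q q≤n) side | yes (s≤s (s≤s _)) | no y =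
    pair {g = gen 1 3 ≤-refl (s≤s (s≤s z≤n)) (<⇒≤ 3<n)} {g′ = gen 1 2 ≤-refl ≤-refl (≤-trans (n≤1+n 2) (<⇒≤ 3<n))}
      (left ≤-refl (n≤1+n 2) (≤-trans 3<n (≮⇒≥ y))) (left ≤-refl ≤-refl p<q)
      (λ ()) (σ-⊑ (≤-refl , n≤1+n 2))
  crossing-pair 3<n a@(gen (suc (suc (suc x))) _ _ p<q q≤n) side | yes (s≤s (s≤s _)) | no y =
    pair {g = gen (suc x) (3 + x) (s≤s z≤n) (n≤1+n _) 3+x≤n} {g′ = gen (2 + x) (3 + x) (s≤s z≤n) ≤-refl 3+x≤n}
      (left (n≤1+n _) ≤-refl p<q) (left ≤-refl ≤-refl p<q)
      (λ e → 1+n≢n (sym (cong p e))) (σ-⊑ (n≤1+n _ , ≤-refl))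
    where
    3+x≤n : 3 + x ≤ n
    3+x≤n = ≤-trans (<⇒≤ p<q) q≤n
  crossing-pair 3<n a side | no x | yes y with 2 + q a ≤? n
  ... | yes z =
    pair {g = gen (q a) (2 + q a) 1≤q (n≤1+n _) z} {g′ = gen (q a) (1 + q a) 1≤q ≤-refl y}
      (right (p<q a) ≤-refl (n≤1+n _)) (right (p<q a) ≤-refl ≤-refl)
      (λ e → 1+n≢n (cong q e)) (σ-⊑ (≤-refl , n≤1+n _))
    where
    1≤q : 1 ≤ q a
    1≤q = ≤-trans (1≤p a) (p≤q a)
  crossing-pair 3<n a@(gen _ zero _ p<q q≤n) side | no x | yes y | no z = contradiction p<q λ ()
  -- Here `a` is [1,n-1] and `r` is n-2; `3 < n` gives `1 < r`, so [n-2,n] does not contain `a`.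
  crossing-pair 3<n a@(gen pa (suc r) _ p<q q≤n) side | no x | yes y | no z =
    pair {g = gen r (2 + r) 1≤r (n≤1+n _) y} {g′ = gen (1 + r) (2 + r) (s≤s z≤n) ≤-refl y}
      (right pa<r (n≤1+n _) ≤-refl) (right p<q ≤-refl ≤-refl)
      (λ e → 1+n≢n (sym (cong p e))) (σ-⊑ (n≤1+n _ , ≤-refl))
    where
    2≤r : 2 ≤ r
    2≤r = s≤s⁻¹ (s≤s⁻¹ (≤-trans 3<n (s≤s⁻¹ (≰⇒> z))))
    1≤r : 1 ≤ r
    1≤r = <⇒≤ 2≤r
    pa<r : pa < r
    pa<r = ≤-trans (≰⇒> x) 2≤r

  -- Central elements and the longest interval

  Central PureCentral : Word n → Set
  Central w = ∀ v → w ++ v ≈ v ++ w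
  PureCentral w = Pure n w × (∀ v → Pure n v → w ++ v ≈ v ++ w)

  commute-≈ : ∀ {w w′ : Word n} v → w ≈ w′ → w ++ v ≈ v ++ w → w′ ++ v ≈ v ++ w′
  commute-≈ v e c = ≈-trans (≈-++ʳ v (≈-sym e)) (≈-trans c (≈-++ˡ v e))

  central-≈ : ∀ {w w′ : Word n} → w ≈ w′ → Central w → Central w′
  central-≈ {w} e c v = commute-≈ {w} v e (c v)

  pureCentral-≈ : ∀ {w w′ : Word n} → w ≈ w′ → PureCentral w → PureCentral w′
  pureCentral-≈ {w} e (pw , c) =
    (λ i 1≤i i≤n → trans (sym (act-≈ e i)) (pw i 1≤i i≤n)) , λ v pv → commute-≈ {w} v e (c v pv)

  reaches-[] : ∀ {a : Gen n} {w} → Geodesic (a ∷ w) → Reaches a [] (a ∷ w)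
  reaches-[] geo = geodesic-desc geo , refl

  central-first-full : ∀ {a : Gen n} {w} → Geodesic (a ∷ w) → Central (a ∷ w) → Full a
  central-first-full {a} {w} geo c = full-if λ side →
    let g , cr = crossing a side in
    contradiction (c (g ∷ [])) (not-central geo cr (reaches-cross {u = []} cr (reaches-[] geo)))

  pureCentral-first-full : 3 < n → ∀ {a : Gen n} {w} → Geodesic (a ∷ w) → PureCentral (a ∷ w) → Full a
  pureCentral-first-full 3<n {a} {w} geo (_ , c) = full-if λ side →
    let pair {g} {g′} cr cr′ g≢g′ fixed = crossing-pair 3<n a side
        u = alternate period a g′ []
    in contradiction (c (probe a g g′) (probe-pure a g g′)) (not-central geo cr
         -- From the inside out: the powers of `a g′` keep `a` as a descent, the pair `g g′`
         -- switches to `g`, and the powers of `g a` keep `g`.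
         (reaches-alternate period (cross-sym cr)
           (reaches-two {u = u} cr cr′ g≢g′ fixed
             (reaches-alternate period {u = []} cr′ (reaches-[] geo)))))

  rev-full : ∀ {t : Gen n} → Full t → ∀ {i j} → 1 ≤ i → i ≤ n → j + i ≡ suc n → rev t i ≡ j
  rev-full {t} (refl , refl) 1≤i i≤n e = rev-unique t (1≤i , i≤n) e

  full-not-pure : 1 < n → ∀ {t : Gen n} → Full t → ¬ Pure n (t ∷ [])
  full-not-pure 1<n full pure = <⇒≢ 1<n
    (trans (sym (pure 1 ≤-refl (<⇒≤ 1<n))) (rev-full full ≤-refl (<⇒≤ 1<n) (+-comm n 1)))

  -- The permutations already fail to commute: on the point 1, `t s` gives n-1, while `s t` gives n,
  -- which `s` fixes because n exceeds 2.
  full-not-central : 2 < n → ∀ {t : Gen n} → Full t → ¬ Central (t ∷ [])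
  full-not-central 2<n {t} full c = <⇒≢ (n<1+n _) (trans (sym left-side) (trans (act-≈ (c (s ∷ [])) 1) right-side))
    where
    s : Gen n
    s = gen 1 2 ≤-refl ≤-refl (<⇒≤ 2<n)
    1≤n : 1 ≤ n
    1≤n = ≤-trans (s≤s z≤n) 2<n
    left-side : rev t (rev s 1) ≡ pred n
    left-side = trans (cong (rev t) (rev-unique s {1} {2} (≤-refl , n≤1+n 1) refl))
      (rev-full full (n≤1+n 1) (<⇒≤ 2<n) (trans (+-comm (pred n) 2) (cong suc (suc-pred n {{>-nonZero 1≤n}}))))
    right-side : rev s (rev t 1) ≡ suc (pred n)
    right-side = trans (cong (rev s) (rev-full full ≤-refl 1≤n (+-comm n 1)))
      (trans (rev-out s λ { (_ , n≤2) → <⇒≱ 2<n n≤2 }) (sym (suc-pred n {{>-nonZero 1≤n}})))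

theoremD : ((n : ℕ) → 2 < n → (w : Word n) →
    ((v : Word n) → (w ++ v) ≈ (v ++ w)) → w ≈ [])
    × ((n : ℕ) → 3 < n → (w : Word n) → Pure n w →
    ((v : Word n) → Pure n v → (w ++ v) ≈ (v ++ w)) → w ≈ [])
theoremD =
  (λ n 2<n → trivial-if-full Central central-≈ central-first-full (full-not-central 2<n)) ,
  (λ n 3<n w pw c → trivial-if-full PureCentral pureCentral-≈ (pureCentral-first-full 3<n)
    (λ full z → full-not-pure (≤-trans (s≤s (s≤s z≤n)) 3<n) full (proj₁ z)) w (pw , c))
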